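{- The lattice of subvarieties of $\mathbf{K}_2$ has cardinality $2^\omega$.
   Context: A pseudocomplemented de Morgan algebra is $(L;\wedge,\vee,{}^\ast,{}^\prime,0,1)$ with bounded distributive lattice reduct, pseudocomplement ${}^\ast$ and de Morgan involution ${}^\prime$. With $x^{0(\prime\ast)}=x$, $x^{(k+1)(\prime\ast)}=((x^{k(\prime\ast)})')^\ast$, $\mathbf{K}_2$ is the variety of such algebras satisfying $x\wedge x^{\prime\ast\prime}\le y\vee y^\ast$ (regularity), $x\wedge x'\le y\vee y'$ (Kleene), and $(x\wedge x^{\prime\ast})^{2(\prime\ast)}=(x\wedge x^{\prime\ast})^{3(\prime\ast)}$ (range $2$). -}

module Defs where

open import Level using (Level; 0ℓ) renaming (suc to lsuc)
open import Algebra.Core using (Op₁; Op₂)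
open import Algebra.Definitions
  using (Congruent₁; Congruent₂; Involutive)
open import Algebra.Lattice.Structures using (IsDistributiveLattice)
open import Data.Nat.Base using (ℕ; zero; suc)
open import Data.Product.Base using (∃; _×_; _,_; proj₁; proj₂)
open import Data.Sum.Base using (inj₁; inj₂; [_,_]′)
open import Function.Base using (id; _∘_)
open import Function.Bundles using (_⇔_; Equivalence; mk⇔)
open import Relation.Binary.Core using (Rel)
open import Relation.Binary.Bundles using (Setoid)
open import Relation.Binary.Structures using (IsEquivalence)
open import Relation.Binary.Lattice.Bundles using (Lattice)
open import Relation.Unary using (Pred; _∈_; _⊆_; _≐_; _∩_; _∪_)
import Relation.Binary.Reasoning.Setoid as SetoidReasoning

1ℓ : Level
1ℓ = lsuc 0ℓ

2ℓ : Level
2ℓ = lsuc 1ℓ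

-- Algebras of type ⟨2,2,1,1,0,0⟩, with no laws imposed.  As elsewhere in the
-- standard library, equality of elements is a setoid equality, so quotients
-- exist.  Carriers are small types.

record Algebra : Set 1ℓ where
  infix  4 _≈_ _≤_
  infixl 9 _* _′
  infixr 7 _∧_
  infixr 6 _∨_
  field
    Carrier       : Set
    _≈_           : Rel Carrier 0ℓ
    _∧_           : Op₂ Carrier
    _∨_           : Op₂ Carrier
    _*            : Op₁ Carrier
    _′            : Op₁ Carrier
    0#            : Carrier
    1#            : Carrier
    isEquivalence : IsEquivalence _≈_
    ∧-cong        : Congruent₂ _≈_ _∧_
    ∨-cong        : Congruent₂ _≈_ _∨_
    *-cong        : Congruent₁ _≈_ _*
    ′-cong        : Congruent₁ _≈_ _′

  setoid : Setoid 0ℓ 0ℓ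
  setoid = record { isEquivalence = isEquivalence }

  _≤_ : Rel Carrier 0ℓ
  x ≤ y = x ∧ y ≈ x

  -- x ^⟨ k ⟩ is x^{k(′*)}.
  _^⟨_⟩ : Carrier → ℕ → Carrier
  x ^⟨ zero ⟩  = x
  x ^⟨ suc k ⟩ = (x ^⟨ k ⟩) ′ *

record IsPseudocomplementedDeMorgan (A : Algebra) : Set where
  open Algebra A
  field
    isDistributiveLattice : IsDistributiveLattice _≈_ _∨_ _∧_
    0-minimum             : ∀ x → 0# ≤ x
    1-maximum             : ∀ x → x ≤ 1#
    -- x * is the largest element disjoint from x.
    pseudocomplement      : ∀ x y → x ∧ y ≈ 0# ⇔ y ≤ x *
    ′-involutive          : Involutive _≈_ _′
    deMorgan              : ∀ x y → (x ∧ y) ′ ≈ x ′ ∨ y ′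

record K₂ (A : Algebra) : Set 1ℓ where
  open Algebra A
  field
    isPseudocomplementedDeMorgan : IsPseudocomplementedDeMorgan A
    regular : ∀ x y → x ∧ x ′ * ′ ≤ y ∨ y *
    kleene  : ∀ x y → x ∧ x ′ ≤ y ∨ y ′
    range   : ∀ x → (x ∧ x ′ *) ^⟨ 2 ⟩ ≈ (x ∧ x ′ *) ^⟨ 3 ⟩

infixl 9 _* _′
infixr 7 _∧_
infixr 6 _∨_

data Term : Set where
  var     : ℕ → Term
  _∧_ _∨_ : Term → Term → Term
  _* _′   : Term → Term
  0# 1#   : Term

module _ (A : Algebra) where
  private module A = Algebra A

  ⟦_⟧ : Term → (ℕ → A.Carrier) → A.Carrier
  ⟦ var n ⟧ ρ = ρ n
  ⟦ s ∧ t ⟧ ρ = ⟦ s ⟧ ρ A.∧ ⟦ t ⟧ ρ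
  ⟦ s ∨ t ⟧ ρ = ⟦ s ⟧ ρ A.∨ ⟦ t ⟧ ρ
  ⟦ t * ⟧   ρ = ⟦ t ⟧ ρ A.*
  ⟦ t ′ ⟧   ρ = ⟦ t ⟧ ρ A.′
  ⟦ 0# ⟧    ρ = A.0#
  ⟦ 1# ⟧    ρ = A.1#

Identity : Set
Identity = Term × Term

infix 4 _⊨_

_⊨_ : Algebra → Identity → Set
A ⊨ (s , t) = ∀ ρ → Algebra._≈_ A (⟦ A ⟧ s ρ) (⟦ A ⟧ t ρ)

Mod : Pred Identity 1ℓ → Pred Algebra 1ℓ
Mod E A = ∀ e → e ∈ E → A ⊨ e

Th : Pred Algebra 1ℓ → Pred Identity 1ℓ
Th C e = ∀ A → A ∈ C → A ⊨ e

IsVariety : Pred Algebra 1ℓ → Set 2ℓ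
IsVariety C = ∃ λ E → C ≐ Mod E

record Subvariety (K : Pred Algebra 1ℓ) : Set 2ℓ where
  field
    class     : Pred Algebra 1ℓ
    isVariety : IsVariety class
    class⊆    : class ⊆ K

open Subvariety

-- Subvarieties are ordered by inclusion and are equal when they have the same
-- members, whichever identities are used to define them.  The join is the class
-- of all models of the common identities, i.e. the least variety containing
-- both; it lies within K because K is a variety.

subvarietyLattice : ∀ {K} → IsVariety K → Lattice 2ℓ 1ℓ 1ℓ
subvarietyLattice {K} (E , K⊆Mod , Mod⊆K) = record
  { Carrier   = Subvariety K
  ; _≈_       = λ V W → class V ≐ class W
  ; _≤_       = λ V W → class V ⊆ class W
  ; _∨_       = join
  ; _∧_       = meet
  ; isLattice = record
    { isPartialOrder = record
      { isPreorder = record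
        { isEquivalence = record
          { refl  = id , id
          ; sym   = λ (p , q) → q , p
          ; trans = λ (p , q) (r , s) → (λ a → r (p a)) , (λ a → q (s a))
          }
        ; reflexive = proj₁
        ; trans     = λ p q a → q (p a)
        }
      ; antisym = _,_
      }
    ; supremum = λ V W →
        (λ a _ t → t _ (inj₁ a))
      , (λ a _ t → t _ (inj₂ a))
      , (λ U V⊆U W⊆U a → let (_ , to , from) = isVariety U in
           from (λ e p → a e λ _ b → to ([ V⊆U , W⊆U ]′ b) e p))
    ; infimum  = λ V W → proj₁ , proj₂ , (λ U p q a → p a , q a)
    }
  }
  where
  join meet : Subvariety K → Subvariety K → Subvariety K
  join V W = record
    { class     = Mod (Th (class V ∪ class W))
    ; isVariety = Th (class V ∪ class W) , id , id
    ; class⊆    = λ a → Mod⊆K λ e p → a e λ _ b →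
                    K⊆Mod ([ class⊆ V , class⊆ W ]′ b) e p
    }
  meet V W = record
    { class     = class V ∩ class W
    ; isVariety =
        let (F , toF , fromF) = isVariety V
            (G , toG , fromG) = isVariety W
        in F ∪ G
         , (λ (a , b) e → [ toF a e , toG b e ]′)
         , (λ a → fromF (λ e → a e ∘ inj₁) , fromG (λ e → a e ∘ inj₂))
    ; class⊆    = λ (a , _) → class⊆ V a
    }

private
  x y z : Term
  x = var 0
  y = var 1
  z = var 2

-- The pseudocomplement is axiomatised by *-∧, *-0 and **-0.
data Axiom : Pred Identity 1ℓ where
  ∨-comm    : Axiom (x ∨ y , y ∨ x)
  ∨-assoc   : Axiom ((x ∨ y) ∨ z , x ∨ (y ∨ z))
  ∧-comm    : Axiom (x ∧ y , y ∧ x)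
  ∧-assoc   : Axiom ((x ∧ y) ∧ z , x ∧ (y ∧ z))
  ∨-absorbs : Axiom (x ∨ (x ∧ y) , x)
  ∧-absorbs : Axiom (x ∧ (x ∨ y) , x)
  ∨-distˡ   : Axiom (x ∨ (y ∧ z) , (x ∨ y) ∧ (x ∨ z))
  ∨-distʳ   : Axiom ((y ∧ z) ∨ x , (y ∨ x) ∧ (z ∨ x))
  ∧-distˡ   : Axiom (x ∧ (y ∨ z) , (x ∧ y) ∨ (x ∧ z))
  ∧-distʳ   : Axiom ((y ∨ z) ∧ x , (y ∧ x) ∨ (z ∧ x))
  0-min     : Axiom (0# ∧ x , 0#)
  1-max     : Axiom (x ∧ 1# , x)
  *-∧       : Axiom (x ∧ (x ∧ y) * , x ∧ y *)
  *-0       : Axiom (x ∧ 0# * , x)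
  **-0      : Axiom (0# * * , 0#)
  ′-inv     : Axiom (x ′ ′ , x)
  ′-∧       : Axiom ((x ∧ y) ′ , x ′ ∨ y ′)
  regular   : Axiom ((x ∧ x ′ * ′) ∧ (y ∨ y *) , x ∧ x ′ * ′)
  kleene    : Axiom ((x ∧ x ′) ∧ (y ∨ y ′) , x ∧ x ′)
  range     : Axiom ((x ∧ x ′ *) ′ * ′ * , (x ∧ x ′ *) ′ * ′ * ′ *)

K₂⇒Mod : K₂ ⊆ Mod Axiom
K₂⇒Mod {A} k e = go
  where
  open Algebra A hiding (_∧_; _∨_; _*; _′; 0#; 1#; ∧-cong; isEquivalence)
  open Algebra A using () renaming
    (_∧_ to infixr 7 _⊓_; _* to infixl 9 _⋆; 0# to 𝟘)
  open K₂ k using (isPseudocomplementedDeMorgan)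
  open IsPseudocomplementedDeMorgan isPseudocomplementedDeMorgan
  module L = IsDistributiveLattice isDistributiveLattice
  open SetoidReasoning setoid

  disjoint⇒≤ : ∀ a b → a ⊓ b ≈ 𝟘 → b ≤ a ⋆
  disjoint⇒≤ a b = Equivalence.to (pseudocomplement a b)

  ⊓-idem : ∀ a → a ⊓ a ≈ a
  ⊓-idem a = begin
    a ⊓ a                          ≈⟨ L.∧-congˡ (L.∨-absorbs-∧ a a) ⟨
    a ⊓ Algebra._∨_ A a (a ⊓ a)    ≈⟨ L.∧-absorbs-∨ a (a ⊓ a) ⟩
    a                              ∎

  disjoint : ∀ a → a ⊓ a ⋆ ≈ 𝟘
  disjoint a = Equivalence.from (pseudocomplement a (a ⋆)) (⊓-idem (a ⋆))

  a⊓[a⊓c]≈ : ∀ a c → a ⊓ (a ⊓ c) ≈ a ⊓ c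
  a⊓[a⊓c]≈ a c = L.trans (L.sym (L.∧-assoc a a c)) (L.∧-congʳ (⊓-idem a))

  ≤-⋆ : ∀ a b → a ⊓ (a ⊓ b) ⋆ ≤ b ⋆
  ≤-⋆ a b = disjoint⇒≤ b _ (begin
    b ⊓ (a ⊓ (a ⊓ b) ⋆)  ≈⟨ L.∧-assoc b a _ ⟨
    (b ⊓ a) ⊓ (a ⊓ b) ⋆  ≈⟨ L.∧-congʳ (L.∧-comm b a) ⟩
    (a ⊓ b) ⊓ (a ⊓ b) ⋆  ≈⟨ disjoint (a ⊓ b) ⟩
    𝟘                    ∎)

  ⋆-≤ : ∀ a b → a ⊓ b ⋆ ≤ (a ⊓ b) ⋆
  ⋆-≤ a b = disjoint⇒≤ (a ⊓ b) _ (begin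
    (a ⊓ b) ⊓ (a ⊓ b ⋆)  ≈⟨ L.∧-congʳ (L.∧-comm a b) ⟩
    (b ⊓ a) ⊓ (a ⊓ b ⋆)  ≈⟨ L.∧-assoc b a _ ⟩
    b ⊓ (a ⊓ (a ⊓ b ⋆))  ≈⟨ L.∧-congˡ (a⊓[a⊓c]≈ a (b ⋆)) ⟩
    b ⊓ (a ⊓ b ⋆)        ≈⟨ L.∧-congˡ (L.∧-comm a (b ⋆)) ⟩
    b ⊓ (b ⋆ ⊓ a)        ≈⟨ L.∧-assoc b (b ⋆) a ⟨
    (b ⊓ b ⋆) ⊓ a        ≈⟨ L.∧-congʳ (disjoint b) ⟩
    𝟘 ⊓ a                ≈⟨ 0-minimum a ⟩
    𝟘                    ∎)

  ⋆-⊓ : ∀ a b → a ⊓ (a ⊓ b) ⋆ ≈ a ⊓ b ⋆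
  ⋆-⊓ a b = begin
    a ⊓ (a ⊓ b) ⋆                ≈⟨ ≤-⋆ a b ⟨
    (a ⊓ (a ⊓ b) ⋆) ⊓ b ⋆        ≈⟨ L.∧-assoc a _ _ ⟩
    a ⊓ ((a ⊓ b) ⋆ ⊓ b ⋆)        ≈⟨ L.∧-congˡ (L.∧-comm _ _) ⟩
    a ⊓ (b ⋆ ⊓ (a ⊓ b) ⋆)        ≈⟨ L.∧-assoc a _ _ ⟨
    (a ⊓ b ⋆) ⊓ (a ⊓ b) ⋆        ≈⟨ ⋆-≤ a b ⟩
    a ⊓ b ⋆                      ∎

  ≤𝟘⋆ : ∀ a → a ≤ 𝟘 ⋆
  ≤𝟘⋆ a = disjoint⇒≤ 𝟘 a (0-minimum a)

  𝟘⋆⋆≈𝟘 : 𝟘 ⋆ ⋆ ≈ 𝟘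
  𝟘⋆⋆≈𝟘 = begin
    𝟘 ⋆ ⋆         ≈⟨ ≤𝟘⋆ (𝟘 ⋆ ⋆) ⟨
    𝟘 ⋆ ⋆ ⊓ 𝟘 ⋆   ≈⟨ L.∧-comm _ _ ⟩
    𝟘 ⋆ ⊓ 𝟘 ⋆ ⋆   ≈⟨ disjoint (𝟘 ⋆) ⟩
    𝟘             ∎

  go : ∀ {e} → e ∈ Axiom → A ⊨ e
  go ∨-comm    ρ = L.∨-comm (ρ 0) (ρ 1)
  go ∨-assoc   ρ = L.∨-assoc (ρ 0) (ρ 1) (ρ 2)
  go ∧-comm    ρ = L.∧-comm (ρ 0) (ρ 1)
  go ∧-assoc   ρ = L.∧-assoc (ρ 0) (ρ 1) (ρ 2)
  go ∨-absorbs ρ = L.∨-absorbs-∧ (ρ 0) (ρ 1)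
  go ∧-absorbs ρ = L.∧-absorbs-∨ (ρ 0) (ρ 1)
  go ∨-distˡ   ρ = proj₁ L.∨-distrib-∧ (ρ 0) (ρ 1) (ρ 2)
  go ∨-distʳ   ρ = proj₂ L.∨-distrib-∧ (ρ 0) (ρ 1) (ρ 2)
  go ∧-distˡ   ρ = proj₁ L.∧-distrib-∨ (ρ 0) (ρ 1) (ρ 2)
  go ∧-distʳ   ρ = proj₂ L.∧-distrib-∨ (ρ 0) (ρ 1) (ρ 2)
  go 0-min     ρ = 0-minimum (ρ 0)
  go 1-max     ρ = 1-maximum (ρ 0)
  go *-∧       ρ = ⋆-⊓ (ρ 0) (ρ 1)
  go *-0       ρ = ≤𝟘⋆ (ρ 0)
  go **-0      ρ = 𝟘⋆⋆≈𝟘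
  go ′-inv     ρ = ′-involutive (ρ 0)
  go ′-∧       ρ = deMorgan (ρ 0) (ρ 1)
  go regular   ρ = K₂.regular k (ρ 0) (ρ 1)
  go kleene    ρ = K₂.kleene k (ρ 0) (ρ 1)
  go range     ρ = K₂.range k (ρ 0)

Mod⇒K₂ : Mod Axiom ⊆ K₂
Mod⇒K₂ {A} m = record
  { isPseudocomplementedDeMorgan = record
    { isDistributiveLattice = isDistributiveLattice
    ; 0-minimum        = λ a → m _ 0-min (env a a a)
    ; 1-maximum        = λ a → m _ 1-max (env a a a)
    ; pseudocomplement = λ a b → mk⇔ (disjoint⇒≤ a b) (≤⇒disjoint a b)
    ; ′-involutive     = λ a → m _ ′-inv (env a a a)
    ; deMorgan         = λ a b → m _ ′-∧ (env a b b)
    }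
  ; regular = λ a b → m _ regular (env a b b)
  ; kleene  = λ a b → m _ kleene (env a b b)
  ; range   = λ a → m _ range (env a a a)
  }
  where
  open Algebra A using (Carrier; _≈_; _≤_; setoid) renaming
    (_∧_ to infixr 7 _⊓_; _* to infixl 9 _⋆; 0# to 𝟘)
  open SetoidReasoning setoid

  env : Carrier → Carrier → Carrier → ℕ → Carrier
  env a b c 0             = a
  env a b c 1             = b
  env a b c (suc (suc _)) = c

  isDistributiveLattice :
    IsDistributiveLattice _≈_ (Algebra._∨_ A) (Algebra._∧_ A)
  isDistributiveLattice = record
    { isLattice = record
      { isEquivalence = Algebra.isEquivalence A
      ; ∨-comm        = λ a b → m _ ∨-comm (env a b b)
      ; ∨-assoc       = λ a b c → m _ ∨-assoc (env a b c)
      ; ∨-cong        = Algebra.∨-cong A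
      ; ∧-comm        = λ a b → m _ ∧-comm (env a b b)
      ; ∧-assoc       = λ a b c → m _ ∧-assoc (env a b c)
      ; ∧-cong        = Algebra.∧-cong A
      ; absorptive    = (λ a b → m _ ∨-absorbs (env a b b))
                      , (λ a b → m _ ∧-absorbs (env a b b))
      }
    ; ∨-distrib-∧ = (λ a b c → m _ ∨-distˡ (env a b c))
                  , (λ a b c → m _ ∨-distʳ (env a b c))
    ; ∧-distrib-∨ = (λ a b c → m _ ∧-distˡ (env a b c))
                  , (λ a b c → m _ ∧-distʳ (env a b c))
    }

  module L = IsDistributiveLattice isDistributiveLattice

  ⋆-⊓ : ∀ a b → a ⊓ (a ⊓ b) ⋆ ≈ a ⊓ b ⋆
  ⋆-⊓ a b = m _ *-∧ (env a b b)

  ≤𝟘⋆ : ∀ a → a ⊓ 𝟘 ⋆ ≈ a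
  ≤𝟘⋆ a = m _ *-0 (env a a a)

  ⊓-zeroʳ : ∀ a → a ⊓ 𝟘 ≈ 𝟘
  ⊓-zeroʳ a = L.trans (L.∧-comm a 𝟘) (m _ 0-min (env a a a))

  disjoint : ∀ a → a ⊓ a ⋆ ≈ 𝟘
  disjoint a = begin
    a ⊓ a ⋆            ≈⟨ L.∧-congˡ (Algebra.*-cong A (≤𝟘⋆ a)) ⟨
    a ⊓ (a ⊓ 𝟘 ⋆) ⋆    ≈⟨ ⋆-⊓ a (𝟘 ⋆) ⟩
    a ⊓ 𝟘 ⋆ ⋆          ≈⟨ L.∧-congˡ (m _ **-0 (env a a a)) ⟩
    a ⊓ 𝟘              ≈⟨ ⊓-zeroʳ a ⟩
    𝟘                  ∎

  disjoint⇒≤ : ∀ a b → a ⊓ b ≈ 𝟘 → b ≤ a ⋆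
  disjoint⇒≤ a b a⊓b≈𝟘 = begin
    b ⊓ a ⋆          ≈⟨ ⋆-⊓ b a ⟨
    b ⊓ (b ⊓ a) ⋆    ≈⟨ L.∧-congˡ (Algebra.*-cong A (L.trans (L.∧-comm b a) a⊓b≈𝟘)) ⟩
    b ⊓ 𝟘 ⋆          ≈⟨ ≤𝟘⋆ b ⟩
    b                ∎

  ≤⇒disjoint : ∀ a b → b ≤ a ⋆ → a ⊓ b ≈ 𝟘
  ≤⇒disjoint a b b≤a⋆ = begin
    a ⊓ b            ≈⟨ L.∧-congˡ b≤a⋆ ⟨
    a ⊓ (b ⊓ a ⋆)    ≈⟨ L.∧-congˡ (L.∧-comm b (a ⋆)) ⟩
    a ⊓ (a ⋆ ⊓ b)    ≈⟨ L.∧-assoc a (a ⋆) b ⟨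
    (a ⊓ a ⋆) ⊓ b    ≈⟨ L.∧-congʳ (disjoint a) ⟩
    𝟘 ⊓ b            ≈⟨ m _ 0-min (env b b b) ⟩
    𝟘                ∎

K₂-isVariety : IsVariety K₂
K₂-isVariety = Axiom , K₂⇒Mod , Mod⇒K₂

K₂-subvarieties : Lattice 2ℓ 1ℓ 1ℓ
K₂-subvarieties = subvarietyLattice K₂-isVariety

{-# OPTIONS --safe #-}

-- Subvarieties are determined by their equational theories, which are subsets
-- of a countable set; by Schröder–Bernstein it remains to embed the subsets of
-- ℕ into the subvarieties, for which it suffices to find algebras Aₘ in K₂ and
-- identities eₖ such that Aₘ ⊨ eₖ exactly when k ≠ m.
--
-- A reflexive symmetric graph gives an algebra of up-sets of a poset of height
-- two, which is regular and Kleene, and has range 2 when any two vertices are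
-- joined by a path of length two.  Take for Aₘ the algebra of the complement of
-- the path with 5 + m points.  There the operation taking a set of points to
-- its common path-neighbours is a term operation.  Starting from a set p, take
-- common neighbours over and over, removing at each step the set before the
-- last.  If p is one end of the path, this walks along the path and the sets
-- become empty after precisely 5 + m of them; for any other p one of the first
-- three is empty.  So the length of the path is expressed by an identity.

module Submission where

open import Defs
open import Axiom.ExcludedMiddle using (ExcludedMiddle)
open import Data.Bool.Base using (Bool)
open import Data.Nat.Base using (ℕ)
open import Function.Bundles using (Bijection)
open import Relation.Binary.Lattice.Bundles using (Lattice)
open import Relation.Binary.PropositionalEquality using (_→-setoid_)

open import Algebra.Lattice.Structures using (IsDistributiveLattice)
open import Data.Bool.Base using (true; false; not; T)
  renaming (_∧_ to infixr 7 _&&_; _∨_ to infixr 6 _||_)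
import Data.Bool.Properties as Bool
import Algebra.Lattice.Properties.BooleanAlgebra as BooleanAlgebra
open import Data.Nat.Base using (zero; suc; _+_; _∸_; _⊔_; _<_; z≤n; s≤s; _≡ᵇ_)
  renaming (_≤_ to _≤ℕ_)
open import Data.Nat.Properties as ℕ using (_≟_)
open import Data.Product.Base
  using (∃; ∃₂; _×_; _,_; proj₁; proj₂)
open import Data.Sum.Base using (_⊎_; inj₁; inj₂; [_,_]′)
open import Data.Unit.Base using (tt)
open import Function.Base using (_∘_; id)
open import Function.Bundles
  using (_⇔_; mk⇔; Equivalence; Injection)
open import Level using (Level; 0ℓ; Lift; lift; lower) renaming (_⊔_ to _⊔ℓ_)
open import Relation.Binary.Bundles using (Setoid)
open import Relation.Binary.Core using (Rel)
open import Relation.Binary.Definitions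
  using (Reflexive; Symmetric)
open import Relation.Binary.PropositionalEquality
  using (_≡_; _≢_; _≗_; refl; sym; trans; cong; cong₂; subst)
open import Relation.Nullary using (¬_; Dec; yes; no; contradiction)
open import Relation.Nullary.Decidable
  using (⌊_⌋; toWitness; fromWitness; decidable-stable; map′; _⊎-dec_)
open import Relation.Unary using (Pred; _∪_)

open Equivalence using (to; from)

private
  variable
    a b ℓ ℓ₁ ℓ₂ : Level

-- Schröder–Bernstein

module _ (em : ExcludedMiddle (a ⊔ℓ ℓ₁ ⊔ℓ b ⊔ℓ ℓ₂))
         {A : Setoid a ℓ₁} {B : Setoid b ℓ₂}
         (f : Injection A B) (g : Injection B A) where
  private
    module A = Setoid A
    module B = Setoid B
    module f = Injection f
    module g = Injection g

    -- The members of A whose backward orbit under g ∘ f ends outside the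
    -- image of g; the level of Lift only brings the type within reach of em.
    data Orphaned (x : A.Carrier) : Set (a ⊔ℓ ℓ₁ ⊔ℓ b ⊔ℓ ℓ₂) where
      base : ¬ Lift (a ⊔ℓ ℓ₁ ⊔ℓ b ⊔ℓ ℓ₂) (∃ λ y → g.to y A.≈ x) → Orphaned x
      step : ∀ {w} → Orphaned w → g.to (f.to w) A.≈ x → Orphaned x

    orphaned-resp : ∀ {x y} → x A.≈ y → Orphaned x → Orphaned y
    orphaned-resp x≈y (base ¬im) =
      base λ (lift (z , gz≈y)) → ¬im (lift (z , A.trans gz≈y (A.sym x≈y)))
    orphaned-resp x≈y (step o gfw≈x) = step o (A.trans gfw≈x x≈y)

    preimage : ∀ {x} → ¬ Orphaned x → ∃ λ y → g.to y A.≈ x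
    preimage {x} ¬o with em {Lift _ (∃ λ y → g.to y A.≈ x)}
    ... | yes (lift im) = im
    ... | no ¬im        = contradiction (base ¬im) ¬o

    h : A.Carrier → B.Carrier
    h x with em {Orphaned x}
    ... | yes _ = f.to x
    ... | no ¬o = proj₁ (preimage ¬o)

    h-orphaned : ∀ {x} → Orphaned x → h x B.≈ f.to x
    h-orphaned {x} o with em {Orphaned x}
    ... | yes _ = B.refl
    ... | no ¬o = contradiction o ¬o

    g∘h : ∀ {x} → ¬ Orphaned x → g.to (h x) A.≈ x
    g∘h {x} ¬o with em {Orphaned x}
    ... | yes o  = contradiction o ¬o
    ... | no ¬o′ = proj₂ (preimage ¬o′)

    h-cong : ∀ {x y} → x A.≈ y → h x B.≈ h y
    h-cong {x} {y} x≈y = go em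
      where
      go : Dec (Orphaned x) → h x B.≈ h y
      go (yes o) = B.trans (h-orphaned o)
        (B.trans (f.cong x≈y) (B.sym (h-orphaned (orphaned-resp x≈y o))))
      go (no ¬o) = g.injective (A.trans (g∘h ¬o)
        (A.trans x≈y (A.sym (g∘h (¬o ∘ orphaned-resp (A.sym x≈y))))))

    -- Applying `g` to `h x ≈ h y` gives `g (f x) ≈ y`, which would make `y` orphaned by `step`.
    separated : ∀ {x y} → Orphaned x → ¬ Orphaned y → ¬ h x B.≈ h y
    separated ox ¬oy hx≈hy = ¬oy (step ox (A.trans
      (g.cong (B.trans (B.sym (h-orphaned ox)) hx≈hy)) (g∘h ¬oy)))

    h-injective : ∀ {x y} → h x B.≈ h y → x A.≈ y
    h-injective {x} {y} hx≈hy = go em em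
      where
      go : Dec (Orphaned x) → Dec (Orphaned y) → x A.≈ y
      go (yes ox) (yes oy) = f.injective (B.trans (B.sym (h-orphaned ox))
                               (B.trans hx≈hy (h-orphaned oy)))
      go (yes ox) (no ¬oy) = contradiction hx≈hy (separated ox ¬oy)
      go (no ¬ox) (yes oy) = contradiction (B.sym hx≈hy) (separated oy ¬ox)
      go (no ¬ox) (no ¬oy) =
        A.trans (A.sym (g∘h ¬ox)) (A.trans (g.cong hx≈hy) (g∘h ¬oy))

    h-surjective : ∀ y → ∃ λ x → h x B.≈ y
    h-surjective y = go em
      where
      go : Dec (Orphaned (g.to y)) → ∃ λ x → h x B.≈ y
      go (no ¬o) = g.to y , g.injective (g∘h ¬o)
      -- The orphan `g y` lies in the image of `g`, so it comes from an orphan `w` with `f w ≈ y`.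
      go (yes (base ¬im)) = contradiction (lift (y , A.refl)) ¬im
      go (yes (step {w} o gfw≈gy)) =
        w , B.trans (h-orphaned o) (g.injective gfw≈gy)

  schröder-bernstein : Bijection A B
  schröder-bernstein = record
    { to        = h
    ; cong      = h-cong
    ; bijective = h-injective , λ y →
        let (x , hx≈y) = h-surjective y in
        x , λ z≈x → B.trans (h-cong z≈x) hx≈y
    }

-- Enumeration of the identities

-- Cantor's walk along the antidiagonals.
next-pair : ℕ × ℕ → ℕ × ℕ
next-pair (zero  , n) = suc n , 0
next-pair (suc m , n) = m , suc n

unpair : ℕ → ℕ × ℕ
unpair zero    = 0 , 0
unpair (suc k) = next-pair (unpair k)

unpair-surjective : ∀ m n → ∃ λ k → unpair k ≡ (m , n)
unpair-surjective m n = go (m + n) m n refl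
  where
  go : ∀ s m n → m + n ≡ s → ∃ λ k → unpair k ≡ (m , n)
  go s       m       (suc n) eq with go s (suc m) n (trans (sym (ℕ.+-suc m n)) eq)
  ... | k , p = suc k , cong next-pair p
  go zero    zero    zero    eq = 0 , refl
  go (suc s) (suc m) zero    eq
    with go s 0 m (trans (sym (ℕ.+-identityʳ m)) (ℕ.suc-injective eq))
  ... | k , p = suc k , cong next-pair p

pair : ℕ → ℕ → ℕ
pair m n = proj₁ (unpair-surjective m n)

unpair-pair : ∀ m n → unpair (pair m n) ≡ (m , n)
unpair-pair m n = proj₂ (unpair-surjective m n)

encode : Term → ℕ
encode (var n) = pair 0 n
encode (s ∧ t) = pair 1 (pair (encode s) (encode t))
encode (s ∨ t) = pair 2 (pair (encode s) (encode t))
encode (t *)   = pair 3 (encode t)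
encode (t ′)   = pair 4 (encode t)
encode 0#      = pair 5 0
encode 1#      = pair 6 0

depth : Term → ℕ
depth (var n) = 1
depth (s ∧ t) = suc (depth s ⊔ depth t)
depth (s ∨ t) = suc (depth s ⊔ depth t)
depth (t *)   = suc (depth t)
depth (t ′)   = suc (depth t)
depth 0#      = 1
depth 1#      = 1

mutual
  -- The first argument is fuel, as recursion on codes is not structural; the depth of the term
  -- suffices.
  decode : ℕ → ℕ → Term
  decode zero    n = 0#
  decode (suc d) n = decodeNode d (unpair n)

  decodeNode : ℕ → ℕ × ℕ → Term
  decodeNode d (0 , n) = var n
  decodeNode d (1 , n) = let (k , l) = unpair n in decode d k ∧ decode d l
  decodeNode d (2 , n) = let (k , l) = unpair n in decode d k ∨ decode d l
  decodeNode d (3 , n) = decode d n *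
  decodeNode d (4 , n) = decode d n ′
  decodeNode d (5 , n) = 0#
  decodeNode d (_ , n) = 1#

decode-encode : ∀ d t → depth t ≤ℕ d → decode d (encode t) ≡ t
decode-encode (suc d) (var n) _ rewrite unpair-pair 0 n = refl
decode-encode (suc d) (s ∧ t) (s≤s p)
  rewrite unpair-pair 1 (pair (encode s) (encode t))
        | unpair-pair (encode s) (encode t)
  = cong₂ _∧_ (decode-encode d s (ℕ.m⊔n≤o⇒m≤o _ _ p))
              (decode-encode d t (ℕ.m⊔n≤o⇒n≤o _ _ p))
decode-encode (suc d) (s ∨ t) (s≤s p)
  rewrite unpair-pair 2 (pair (encode s) (encode t))
        | unpair-pair (encode s) (encode t)
  = cong₂ _∨_ (decode-encode d s (ℕ.m⊔n≤o⇒m≤o _ _ p))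
              (decode-encode d t (ℕ.m⊔n≤o⇒n≤o _ _ p))
decode-encode (suc d) (t *) (s≤s p)
  rewrite unpair-pair 3 (encode t) = cong _* (decode-encode d t p)
decode-encode (suc d) (t ′) (s≤s p)
  rewrite unpair-pair 4 (encode t) = cong _′ (decode-encode d t p)
decode-encode (suc d) 0# _ rewrite unpair-pair 5 0 = refl
decode-encode (suc d) 1# _ rewrite unpair-pair 6 0 = refl

-- The fuel is coded along with the two terms, so every depth is reached.
identity : ℕ → Identity
identity n =
  let (d , kl) = unpair n
      (k , l)  = unpair kl
  in decode d k , decode d l

identity-surjective : ∀ e → ∃ λ n → identity n ≡ e
identity-surjective (s , t) = pair d (pair (encode s) (encode t)) , eq
  where
  d = depth s ⊔ depth t
  eq : identity (pair d (pair (encode s) (encode t))) ≡ (s , t)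
  eq rewrite unpair-pair d (pair (encode s) (encode t))
           | unpair-pair (encode s) (encode t)
    = cong₂ _,_ (decode-encode d s (ℕ.m≤m⊔n _ _))
                (decode-encode d t (ℕ.m≤n⊔m _ _))

-- Subvarieties as sets of identities

T-ext : ∀ {p q} → T p ⇔ T q → p ≡ q
T-ext p⇔q = Bool.⇔→≡ (mk⇔ (to Bool.T-≡ ∘ to p⇔q ∘ from Bool.T-≡)
                            (to Bool.T-≡ ∘ from p⇔q ∘ from Bool.T-≡))

T-not : ∀ {p} → T (not p) ⇔ (¬ T p)
T-not {true}  = mk⇔ (λ ()) (λ ¬p → ¬p tt)
T-not {false} = mk⇔ (λ _ ()) (λ _ → tt)

⌊⌋⇔ : {P : Set ℓ} (P? : Dec P) → T ⌊ P? ⌋ ⇔ P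
⌊⌋⇔ P? = mk⇔ (toWitness {a? = P?}) (fromWitness {a? = P?})

lower-em : ∀ ℓ₁ {ℓ₂} → ExcludedMiddle (ℓ₁ ⊔ℓ ℓ₂) → ExcludedMiddle ℓ₂
lower-em ℓ₁ em {P} = map′ lower lift (em {Lift ℓ₁ P})

-- A member of `V` satisfies the theory of `V`, hence that of `W`, hence the identities defining
-- `W`.
subvariety⊆-Th : ∀ {K} (V W : Subvariety K) →
  (∀ e → Th (Subvariety.class W) e → Th (Subvariety.class V) e) →
  ∀ {A} → Subvariety.class V A → Subvariety.class W A
subvariety⊆-Th V W Th⊆ A∈V =
  let (_ , toW , fromW) = Subvariety.isVariety W in
  fromW λ e e∈E → Th⊆ e (λ _ B∈W → toW B∈W e e∈E) _ A∈V

module _ (em : ExcludedMiddle 1ℓ) {K : Pred Algebra 1ℓ} (K-isVariety : IsVariety K) where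

  private
    theory : Subvariety K → ℕ → Bool
    theory V n = ⌊ em {Th (Subvariety.class V) (identity n)} ⌋

    theory⇔ : ∀ V n → T (theory V n) ⇔ Th (Subvariety.class V) (identity n)
    theory⇔ V n = ⌊⌋⇔ em

    theory-resp : ∀ V W → theory V ≗ theory W →
      ∀ e → Th (Subvariety.class V) e → Th (Subvariety.class W) e
    theory-resp V W V≗W e e∈V with identity-surjective e
    ... | n , refl = to (theory⇔ W n) (subst T (V≗W n) (from (theory⇔ V n) e∈V))

  subvarieties↣subsets :
    Injection (Lattice.setoid (subvarietyLattice K-isVariety)) (ℕ →-setoid Bool)
  subvarieties↣subsets = record
    { to        = theory
    ; cong      = λ {V} {W} (V⊆W , W⊆V) n → T-ext (mk⇔
        (λ t → from (theory⇔ W n) λ A → to (theory⇔ V n) t A ∘ W⊆V)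
        (λ t → from (theory⇔ V n) λ A → to (theory⇔ W n) t A ∘ V⊆W))
    ; injective = λ {V} {W} V≗W →
          subvariety⊆-Th V W (theory-resp W V (sym ∘ V≗W))
        , subvariety⊆-Th W V (theory-resp V W V≗W)
    }

-- Algebras of graphs

module GraphAlgebra (em : ExcludedMiddle 0ℓ) {V : Set} (R : Rel V 0ℓ)
  (R-refl : Reflexive R) (R-sym : Symmetric R)
  (R² : ∀ u v → ∃ λ w → R u w × R w v) where

  -- Boolean values keep the type of up-sets small, as carriers must be; excluded middle makes the
  -- diamond Boolean.
  ◇ : (V → Bool) → V → Bool
  ◇ B v = ⌊ em {∃ λ w → R v w × T (B w)} ⌋

  ◇⇔ : ∀ {B v} → T (◇ B v) ⇔ (∃ λ w → R v w × T (B w))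
  ◇⇔ = ⌊⌋⇔ em

  -- The up-sets of the poset V × {lower , upper} in which the only strict
  -- inequalities are (v , lower) < (w , upper) for R v w.
  record UpSet : Set where
    field
      lower  : V → Bool
      upper  : V → Bool
      closed : ∀ {v w} → R v w → T (lower v) → T (upper w)

  open UpSet public

  algebra : Algebra
  algebra = record
    { Carrier       = UpSet
    ; _≈_           = λ x y → lower x ≗ lower y × upper x ≗ upper y
    ; _∧_           = λ x y → record
      { lower  = λ v → lower x v && lower y v
      ; upper  = λ v → upper x v && upper y v
      ; closed = λ {v} vRw p → let (q , r) = to (Bool.T-∧ {lower x v}) p in
          from Bool.T-∧ (closed x vRw q , closed y vRw r)
      }
    ; _∨_           = λ x y → record
      { lower  = λ v → lower x v || lower y v
      ; upper  = λ v → upper x v || upper y v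
      ; closed = λ {v} {w} vRw p → from (Bool.T-∨ {upper x w})
          ([ inj₁ ∘ closed x vRw , inj₂ ∘ closed y vRw ]′
            (to (Bool.T-∨ {lower x v}) p))
      }
    -- Deleting every lower point below an upper point of `x` also deletes the lower points of `x`,
    -- since `R` is reflexive.
    ; _*            = λ x → record
      { lower  = λ v → not (◇ (upper x) v)
      ; upper  = λ v → not (upper x v)
      ; closed = λ vRw p → from T-not λ q → to T-not p (from ◇⇔ (_ , vRw , q))
      }
    -- The complement of the image under the swap of the two levels, which reverses the order
    -- because `R` is symmetric.
    ; _′            = λ x → record
      { lower  = λ v → not (upper x v)
      ; upper  = λ v → not (lower x v)
      ; closed = λ vRw p → from T-not λ q → to T-not p (closed x (R-sym vRw) q)
      }
    ; 0#            = record { lower = λ _ → false ; upper = λ _ → false ; closed = λ _ () }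
    ; 1#            = record { lower = λ _ → true ; upper = λ _ → true ; closed = λ _ _ → tt }
    ; isEquivalence = record
      { refl  = (λ _ → refl) , (λ _ → refl)
      ; sym   = λ (p , q) → (sym ∘ p) , (sym ∘ q)
      ; trans = λ (p , q) (r , s) → (λ v → trans (p v) (r v)) , (λ v → trans (q v) (s v))
      }
    ; ∧-cong        = λ (p , q) (r , s) →
        (λ v → cong₂ _&&_ (p v) (r v)) , (λ v → cong₂ _&&_ (q v) (s v))
    ; ∨-cong        = λ (p , q) (r , s) →
        (λ v → cong₂ _||_ (p v) (r v)) , (λ v → cong₂ _||_ (q v) (s v))
    ; *-cong        = λ (p , q) → (λ v → cong not (◇-cong q v)) , (cong not ∘ q)
    ; ′-cong        = λ (p , q) → (cong not ∘ q) , (cong not ∘ p)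
    }
    where
    ◇-mono : ∀ {B C} → B ≗ C → ∀ v → T (◇ B v) → T (◇ C v)
    ◇-mono B≗C v p = let (w , vRw , q) = to ◇⇔ p in
      from ◇⇔ (w , vRw , subst T (B≗C w) q)

    ◇-cong : ∀ {B C} → B ≗ C → ◇ B ≗ ◇ C
    ◇-cong B≗C v = T-ext (mk⇔ (◇-mono B≗C v) (◇-mono (sym ∘ B≗C) v))

  open Algebra algebra using (_≈_; _≤_; _^⟨_⟩; ∧-cong; ∨-cong) renaming
    (_∧_ to infixr 7 _⊓_; _* to infixl 9 _⋆; _′ to infixl 9 _ᵈ; 0# to 𝟘)

  lower⇒upper : ∀ x {v} → T (lower x v) → T (upper x v)
  lower⇒upper x = closed x R-refl

  -- `ᵈ` puts the complement of the lower part on the upper level, the only one that `⋆` reads; so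
  -- `ᵈ ⋆` is the box of the graph on lower parts.
  lower-□ : ∀ x {v} → T (lower (x ᵈ ⋆) v) ⇔ (∀ w → R v w → T (lower x w))
  lower-□ x {v} = mk⇔
    (λ p w vRw → decidable-stable em λ ¬q →
      to T-not p (from ◇⇔ (w , vRw , from T-not ¬q)))
    (λ f → from T-not λ p → let (w , vRw , q) = to ◇⇔ p in to T-not q (f w vRw))

  upper-□ : ∀ x {v} → T (upper (x ᵈ ⋆) v) ⇔ T (lower x v)
  upper-□ x {v} = mk⇔ (subst T (Bool.not-involutive (lower x v)))
                       (subst T (sym (Bool.not-involutive (lower x v))))

  infix 4 _⊩_

  -- Upper parts suffice: those of `x ⋆` and `x ⋆ ᵈ` depend only on that of `x`, and by reflexivity
  -- an up-set with empty upper part is empty.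
  _⊩_ : V → UpSet → Set
  v ⊩ x = T (upper x v)

  ⊩-⊓ : ∀ x y v → v ⊩ x ⊓ y ⇔ (v ⊩ x × v ⊩ y)
  ⊩-⊓ x y v = Bool.T-∧

  ⊩-◇ : ∀ x v → v ⊩ x ⋆ ᵈ ⇔ (∃ λ w → R v w × w ⊩ x)
  ⊩-◇ x v = mk⇔ (to ◇⇔ ∘ subst T (Bool.not-involutive (◇ (upper x) v)))
                   (subst T (sym (Bool.not-involutive (◇ (upper x) v))) ∘ from ◇⇔)

  ≈0⇔unforced : ∀ x → x ≈ 𝟘 ⇔ (∀ v → ¬ v ⊩ x)
  ≈0⇔unforced x = mk⇔
    (λ (_ , p) v q → subst T (p v) q)
    (λ f → (λ v → to Bool.T-not-≡ (from T-not (f v ∘ lower⇒upper x)))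
         , (λ v → to Bool.T-not-≡ (from T-not (f v))))

  ⊩-◆ : ∀ x v → v ⊩ x ⋆ ᵈ ⋆ ᵈ ⇔ (∃ λ w → w ⊩ x)
  ⊩-◆ x v = mk⇔
    (λ p → let (_ , _ , q) = to (⊩-◇ (x ⋆ ᵈ) v) p
               (w , _ , r) = to (⊩-◇ x _) q
           in w , r)
    (λ (w , p) → let (u , vRu , uRw) = R² v w in
      from (⊩-◇ (x ⋆ ᵈ) v) (u , vRu , from (⊩-◇ x u) (w , uRw , p)))

  private
    Full : UpSet → Set
    Full x = ∀ v → T (lower x v)

    lower-□² : ∀ x {v} → T (lower (x ^⟨ 2 ⟩) v) ⇔ Full x
    lower-□² x {v} = mk⇔
      (λ p w → let (u , vRu , uRw) = R² v w in
        to (lower-□ x) (to (lower-□ (x ᵈ ⋆)) p u vRu) w uRw)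
      (λ f → from (lower-□ (x ᵈ ⋆)) λ u _ → from (lower-□ x) λ w _ → f w)

    lower-⊓□ : ∀ x {v} →
      T (lower (x ⊓ x ᵈ ⋆) v) ⇔ (∀ w → R v w → T (lower x w))
    lower-⊓□ x = mk⇔
      (to (lower-□ x) ∘ proj₂ ∘ to Bool.T-∧)
      (λ f → from Bool.T-∧ (f _ R-refl , from (lower-□ x) f))

    range-lower : ∀ x v → T (lower (x ^⟨ 2 ⟩) v) ⇔ T (lower (x ^⟨ 3 ⟩) v)
    range-lower x v = mk⇔
      (λ p → from (lower-□² (x ᵈ ⋆)) λ w → from (lower-□ x) λ u _ →
        to (lower-□² x) p u)
      (λ p → from (lower-□² x) λ w →
        to (lower-□ x) (to (lower-□² (x ᵈ ⋆)) p w) w R-refl)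

    -- Upper parts lag one box behind lower ones, so that of `y ^⟨ 2 ⟩` is a single box of `y`. But
    -- the lower part of `y` is itself a box of that of `x`, and by `R²` these two boxes together
    -- see every vertex.
    range-upper : ∀ x v → let y = x ⊓ x ᵈ ⋆ in
      T (upper (y ^⟨ 2 ⟩) v) ⇔ T (upper (y ^⟨ 3 ⟩) v)
    range-upper x v = let y = x ⊓ x ᵈ ⋆ in mk⇔
      (λ p → from (upper-□ (y ^⟨ 2 ⟩)) (from (lower-□² y) λ w →
        from (lower-⊓□ x) λ u _ →
          let (t , vRt , tRu) = R² v u in
          to (lower-⊓□ x) (to (lower-□ y) (to (upper-□ (y ^⟨ 1 ⟩)) p) t vRt) u tRu))
      (λ p → from (upper-□ (y ^⟨ 1 ⟩)) (from (lower-□ y) λ w _ →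
        to (lower-□² y) (to (upper-□ (y ^⟨ 2 ⟩)) p) w))

    &&-≡ˡ : ∀ {p q} → (T p → T q) → p && q ≡ p
    &&-≡ˡ p⇒q = T-ext (mk⇔ (proj₁ ∘ to Bool.T-∧) (λ p → from Bool.T-∧ (p , p⇒q p)))

    &&-≡ˡ⁻¹ : ∀ {p q} → p && q ≡ p → T p → T q
    &&-≡ˡ⁻¹ eq p = proj₂ (to Bool.T-∧ (subst T (sym eq) p))

    &&-≡false⇒disjoint : ∀ {p q} → p && q ≡ false → T p → ¬ T q
    &&-≡false⇒disjoint eq p q = subst T eq (from Bool.T-∧ (p , q))

    disjoint⇔≤⋆ : ∀ x y → x ⊓ y ≈ 𝟘 ⇔ y ≤ x ⋆
    disjoint⇔≤⋆ x y = mk⇔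
      (λ (_ , p) →
          (λ v → &&-≡ˡ λ q → from T-not λ r →
            let (w , vRw , s) = to ◇⇔ r in
            &&-≡false⇒disjoint (p w) s (closed y vRw q))
        , (λ v → &&-≡ˡ λ q → from T-not λ r → &&-≡false⇒disjoint (p v) r q))
      (λ (_ , q) → from (≈0⇔unforced (x ⊓ y)) λ v r →
        let (s , t) = to (⊩-⊓ x y v) r in to T-not (&&-≡ˡ⁻¹ (q v) t) s)

  algebra∈K₂ : K₂ algebra
  algebra∈K₂ = record
    { isPseudocomplementedDeMorgan = record
      { isDistributiveLattice = record
        { isLattice = record
          { isEquivalence = Algebra.isEquivalence algebra
          ; ∨-comm        = λ x y →
              (λ v → 𝔹.∨-comm (lower x v) _) , (λ v → 𝔹.∨-comm (upper x v) _)
          ; ∨-assoc       = λ x y z →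
              (λ v → 𝔹.∨-assoc (lower x v) _ _) , (λ v → 𝔹.∨-assoc (upper x v) _ _)
          ; ∨-cong        = λ {x} {y} {z} {w} → ∨-cong {x} {y} {z} {w}
          ; ∧-comm        = λ x y →
              (λ v → 𝔹.∧-comm (lower x v) _) , (λ v → 𝔹.∧-comm (upper x v) _)
          ; ∧-assoc       = λ x y z →
              (λ v → 𝔹.∧-assoc (lower x v) _ _) , (λ v → 𝔹.∧-assoc (upper x v) _ _)
          ; ∧-cong        = λ {x} {y} {z} {w} → ∧-cong {x} {y} {z} {w}
          ; absorptive    =
              (λ x y →
                  (λ v → 𝔹.∨-absorbs-∧ (lower x v) _)
                , (λ v → 𝔹.∨-absorbs-∧ (upper x v) _))
            , (λ x y →
                (λ v → 𝔹.∧-absorbs-∨ (lower x v) _) , (λ v → 𝔹.∧-absorbs-∨ (upper x v) _))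
          }
        ; ∨-distrib-∧ =
            (λ x y z →
                (λ v → proj₁ 𝔹.∨-distrib-∧ (lower x v) _ _)
              , (λ v → proj₁ 𝔹.∨-distrib-∧ (upper x v) _ _))
          , (λ x y z →
              (λ v → proj₂ 𝔹.∨-distrib-∧ (lower x v) (lower y v) _)
            , (λ v → proj₂ 𝔹.∨-distrib-∧ (upper x v) (upper y v) _))
        ; ∧-distrib-∨ =
            (λ x y z →
                (λ v → proj₁ 𝔹.∧-distrib-∨ (lower x v) _ _)
              , (λ v → proj₁ 𝔹.∧-distrib-∨ (upper x v) _ _))
          , (λ x y z →
              (λ v → proj₂ 𝔹.∧-distrib-∨ (lower x v) (lower y v) _)
            , (λ v → proj₂ 𝔹.∧-distrib-∨ (upper x v) (upper y v) _))
        }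
      ; 0-minimum        = λ x → (λ _ → refl) , (λ _ → refl)
      ; 1-maximum        = λ x → (λ v → Bool.∧-identityʳ _) , (λ v → Bool.∧-identityʳ _)
      ; pseudocomplement = disjoint⇔≤⋆
      ; ′-involutive     = λ x → (λ v → Bool.not-involutive _) , (λ v → Bool.not-involutive _)
      ; deMorgan         = λ x y →
          (λ v → 𝔹ᵇ.deMorgan₁ (upper x v) _) , (λ v → 𝔹ᵇ.deMorgan₁ (lower x v) _)
      }
    -- Here and for `kleene`, the left side has an empty lower part and the right side a full upper
    -- part.
    ; regular = λ x y →
        (λ v → &&-≡ˡ λ p → let (q , r) = to Bool.T-∧ p in
          contradiction (from (upper-□ x) q) (to T-not r))
      , (λ v → &&-≡ˡ λ _ → subst T (sym (Bool.∨-inverseʳ (upper y v))) tt)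
    ; kleene  = λ x y →
        (λ v → &&-≡ˡ λ p → let (q , r) = to Bool.T-∧ p in
          contradiction (lower⇒upper x q) (to T-not r))
      , (λ v → &&-≡ˡ λ _ → from (Bool.T-∨ {upper y v}) (upper∨¬lower y v))
    ; range   = λ x →
        (λ v → T-ext (range-lower (x ⊓ x ᵈ ⋆) v))
      , (λ v → T-ext (range-upper x v))
    }
    where
    module 𝔹 = IsDistributiveLattice Bool.∨-∧-isDistributiveLattice
    module 𝔹ᵇ = BooleanAlgebra Bool.∨-∧-booleanAlgebra

    upper∨¬lower : ∀ y v → T (upper y v) ⊎ T (not (lower y v))
    upper∨¬lower y v with em {v ⊩ y}
    ... | yes p = inj₁ p
    ... | no ¬p = inj₂ (from T-not (¬p ∘ lower⇒upper y))

-- Upper parts of up-sets compute modal formulas: t * negates and t * ′ is the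
-- diamond of the graph, so ◆ is the global existential modality when any two
-- vertices are joined by a path of length two.
◆_ : Term → Term
◆ t = t * ′ * ′

-- On the complement of a path, beyond s t holds at the points outside s that
-- are consecutive to every point of t: if s and t are consecutive points, it
-- is the point following t, as long as there is one.
beyond : Term → Term → Term
beyond s t = t * ′ * ∧ s *

-- Iterating beyond yields exactly k further nonempty sets.
chain : ℕ → Term → Term → Term
chain zero    s t = (◆ beyond s t) *
chain (suc k) s t = (◆ beyond s t) ∧ chain k t (beyond s t)

P₁ P₂ : Term → Term
P₁ p = beyond 0# p
P₂ p = beyond p (P₁ p)

-- From an end of a path with `5 + m` points, `4 + m` others follow, so the identity should fail
-- precisely for `k = m`.
chainIdentity : ℕ → Identity
chainIdentity k = chain (4 + k) 0# (var 0) , 0#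

-- Complements of paths

-- Recording the distances to both ends makes reversal symmetric; there are `n + 1` points.
Path : ℕ → Set
Path n = ∃₂ λ i j → i + j ≡ n

Consecutive : Rel ℕ 0ℓ
Consecutive i j = suc i ≡ j ⊎ suc j ≡ i

3-apart : ∀ k → ¬ Consecutive k (3 + k)
3-apart k = [ ℕ.<⇒≢ (ℕ.m<n+m (suc k) {2} (s≤s z≤n))
            , ℕ.<⇒≢ (ℕ.m<n+m k {4} (s≤s z≤n)) ∘ sym ]′

module _ {n : ℕ} where

  left right : Path n → ℕ
  left  (i , _ , _) = i
  right (_ , j , _) = j

  Adjacent Apart : Rel (Path n) 0ℓ
  Adjacent u v = Consecutive (left u) (left v)
  Apart u v    = ¬ Adjacent u v

  left-injective : ∀ {u v} → left u ≡ left v → u ≡ v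
  left-injective {i , j , p} {_ , j′ , q} refl
    with refl ← ℕ.+-cancelˡ-≡ i j j′ (trans p (sym q))
    = cong (λ r → i , j , r) (ℕ.≡-irrelevant p q)

  right-injective : ∀ {u v} → right u ≡ right v → u ≡ v
  right-injective {i , j , p} {i′ , _ , q} refl =
    left-injective (ℕ.+-cancelʳ-≡ j i i′ (trans p (sym q)))

  left⇒right : ∀ u v → suc (left u) ≡ left v → suc (right v) ≡ right u
  left⇒right (i , j , p) (_ , j′ , q) refl =
    ℕ.+-cancelˡ-≡ i (suc j′) j (trans (ℕ.+-suc i j′) (trans q (sym p)))

  right⇒left : ∀ u v → suc (right u) ≡ right v → suc (left v) ≡ left u
  right⇒left (i , j , p) (i′ , _ , q) refl =
    ℕ.+-cancelʳ-≡ j (suc i′) i (trans (sym (ℕ.+-suc i′ j)) (trans q (sym p)))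

  adjacent? : ∀ u v → Dec (Adjacent u v)
  adjacent? u v = (suc (left u) ≟ left v) ⊎-dec (suc (left v) ≟ left u)

-- The distance from one of the two ends, so that a path can be read in either
-- direction.
record Coordinate (n : ℕ) : Set where
  field
    coord     : Path n → ℕ
    injective : ∀ {u v} → coord u ≡ coord v → u ≡ v
    bounded   : ∀ v → coord v ≤ℕ n
    point     : ∀ {k} → k ≤ℕ n → ∃ λ v → coord v ≡ k
    adjacent  : ∀ u v → Adjacent u v ⇔ Consecutive (coord u) (coord v)

module _ {n : ℕ} where

  leftward rightward : Coordinate n
  leftward = record
    { coord     = left
    ; injective = left-injective
    ; bounded   = λ (i , j , p) → subst (i ≤ℕ_) p (ℕ.m≤m+n i j)
    ; point     = λ {k} k≤n → (k , n ∸ k , ℕ.m+[n∸m]≡n k≤n) , refl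
    ; adjacent  = λ _ _ → mk⇔ id id
    }
  rightward = record
    { coord     = right
    ; injective = right-injective
    ; bounded   = λ (i , j , p) → subst (j ≤ℕ_) p (ℕ.m≤n+m j i)
    ; point     = λ {k} k≤n → (n ∸ k , k , ℕ.m∸n+n≡m k≤n) , refl
    ; adjacent  = λ u v → mk⇔
        [ inj₂ ∘ left⇒right u v , inj₁ ∘ left⇒right v u ]′
        [ inj₂ ∘ right⇒left u v , inj₁ ∘ right⇒left v u ]′
    }

  apart-refl : ∀ (v : Path n) → Apart v v
  apart-refl _ = [ ℕ.1+n≢n , ℕ.1+n≢n ]′

  apart-sym : ∀ (u v : Path n) → Apart u v → Apart v u
  apart-sym _ _ u#v = u#v ∘ [ inj₂ , inj₁ ]′

-- Two consecutive points of a path on at least five points have a common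
-- non-neighbour: an end of the path, or else the point with left = 4.
apart² : ∀ {m} (u v : Path (4 + m)) → ∃ λ w → Apart u w × Apart w v
apart² {m} = λ u v → go u v (adjacent? u v)
  where
  consecutive : ∀ (u v : Path (4 + m)) → suc (left u) ≡ left v →
    ∃ λ w → Apart u w × Apart w v
  consecutive (0 , _) _ refl =
    (4 , m , refl) , [ (λ ()) , (λ ()) ]′ , [ (λ ()) , (λ ()) ]′
  consecutive (1 , _) _ refl =
    (4 , m , refl) , [ (λ ()) , (λ ()) ]′ , [ (λ ()) , (λ ()) ]′
  consecutive (suc (suc _) , _) _ refl =
    (0 , 4 + m , refl) , [ (λ ()) , (λ ()) ]′ , [ (λ ()) , (λ ()) ]′

  go : ∀ (u v : Path (4 + m)) → Dec (Adjacent u v) → ∃ λ w → Apart u w × Apart w v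
  go u v (no u#v)         = v , u#v , apart-refl v
  go u v (yes (inj₁ u→v)) = consecutive u v u→v
  go u v (yes (inj₂ v→u)) with consecutive v u v→u
  ... | w , v#w , w#u = w , apart-sym w u w#u , apart-sym v w v#w

-- If w is adjacent to all of F and v, outside F, is adjacent to every such w,
-- then F is a single end of the path: since w has at most two neighbours,
-- F = {b} with b and v on either side of w, and a second neighbour of b would
-- not be adjacent to v.
module _ {n : ℕ} (F : Path n → Set) {b v w : Path n} (Fb : F b)
         (w~F : ∀ c → F c → Adjacent w c) (¬Fv : ¬ F v)
         (v~F~ : ∀ u → (∀ c → F c → Adjacent u c) → Adjacent v u) where

  private
    end-of-coordinate : (d : Coordinate n) → let open Coordinate d in
      suc (coord v) ≡ coord w → suc (coord w) ≡ coord b → ∀ c → F c ⇔ coord c ≡ n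
    end-of-coordinate d v→w w→b c = mk⇔
      (λ Fc → subst (λ x → coord x ≡ n) (sym (only-b c Fc)) b≡n)
      (λ c≡n → subst F (injective (trans b≡n (sym c≡n))) Fb)
      where
      open Coordinate d

      only-b : ∀ c → F c → c ≡ b
      only-b c Fc with to (adjacent w c) (w~F c Fc)
      ... | inj₁ w→c = injective (trans (sym w→c) w→b)
      ... | inj₂ c→w = contradiction
        (subst F (injective (ℕ.suc-injective (trans c→w (sym v→w)))) Fc) ¬Fv

      b≮n : ¬ coord b < n
      b≮n b<n =
        let (u , u≡1+b) = point b<n
            u≡3+v       = trans u≡1+b (cong suc (sym (trans (cong suc v→w) w→b)))
            v~u         = v~F~ u λ c Fc → from (adjacent u c)
              (inj₂ (trans (cong (suc ∘ coord) (only-b c Fc)) (sym u≡1+b)))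
        in 3-apart (coord v)
             (subst (Consecutive (coord v)) u≡3+v (to (adjacent v u) v~u))

      b≡n : coord b ≡ n
      b≡n = [ (λ b<n → contradiction b<n b≮n) , id ]′ (ℕ.m≤n⇒m<n∨m≡n (bounded b))

  end-of-path : ∃ λ (d : Coordinate n) → ∀ c → F c ⇔ Coordinate.coord d c ≡ n
  end-of-path with v~F~ w w~F | w~F b Fb
  ... | inj₁ v→w | inj₁ w→b = leftward , end-of-coordinate leftward v→w w→b
  ... | inj₂ w→v | inj₂ b→w = rightward ,
    end-of-coordinate rightward (left⇒right w v w→v) (left⇒right b w b→w)
  ... | inj₁ v→w | inj₂ b→w = contradiction
    (subst F (left-injective (ℕ.suc-injective (trans b→w (sym v→w)))) Fb) ¬Fv
  ... | inj₂ w→v | inj₁ w→b = contradiction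
    (subst F (left-injective (trans (sym w→b) w→v)) Fb) ¬Fv

-- Chains in the algebra of the complement of a path

module PathAlgebra (em : ExcludedMiddle 0ℓ) (m : ℕ) where

  n : ℕ
  n = 4 + m

  open GraphAlgebra em (Apart {n})
    (λ {v} → apart-refl v) (λ {u} {v} → apart-sym u v) apart²

  pathAlgebra : Algebra
  pathAlgebra = algebra

  pathAlgebra∈K₂ : K₂ pathAlgebra
  pathAlgebra∈K₂ = algebra∈K₂

  private
    infix 4 _⊢_⊩_
    _⊢_⊩_ : (ℕ → UpSet) → Path n → Term → Set
    ρ ⊢ v ⊩ t = _⊩_ v (⟦ pathAlgebra ⟧ t ρ)

  module _ (ρ : ℕ → UpSet) where
    private
      val : Term → UpSet
      val t = ⟦ pathAlgebra ⟧ t ρ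

    ⊩-beyond : ∀ s t v →
      ρ ⊢ v ⊩ beyond s t ⇔ ((∀ w → ρ ⊢ w ⊩ t → Adjacent v w) × ¬ ρ ⊢ v ⊩ s)
    ⊩-beyond s t v = mk⇔
      (λ p → let (q , r) = to Bool.T-∧ p in
          (λ w w⊩t → decidable-stable (adjacent? v w) λ v#w →
            to T-not q (from (⊩-◇ (val t) v) (w , v#w , w⊩t)))
        , to T-not r)
      (λ (f , v⊮s) → from Bool.T-∧
          ( from T-not (λ q → let (w , v#w , w⊩t) = to (⊩-◇ (val t) v) q in
              v#w (f w w⊩t))
          , from T-not v⊮s))

    ⊩-link : ∀ j s t v → ρ ⊢ v ⊩ chain (suc j) s t ⇔
      ((∃ λ w → ρ ⊢ w ⊩ beyond s t) × ρ ⊢ v ⊩ chain j t (beyond s t))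
    ⊩-link j s t v = mk⇔
      (λ p → let (q , r) = to (⊩-⊓ (val (◆ beyond s t)) (val rest) v) p in
        to (⊩-◆ (val (beyond s t)) v) q , r)
      (λ (q , r) → from (⊩-⊓ (val (◆ beyond s t)) (val rest) v)
        (from (⊩-◆ (val (beyond s t)) v) q , r))
      where rest = chain j t (beyond s t)

    ⊩-last : ∀ s t v → ρ ⊢ v ⊩ chain 0 s t ⇔ (¬ ∃ λ w → ρ ⊢ w ⊩ beyond s t)
    ⊩-last s t v = mk⇔
      (λ p → to T-not p ∘ from (⊩-◆ (val (beyond s t)) v))
      (λ ¬q → from T-not (¬q ∘ to (⊩-◆ (val (beyond s t)) v)))

    module _ (d : Coordinate n) where
      open Coordinate d

      AtLevel : ℕ → Term → Set
      AtLevel k t = ∀ v → ρ ⊢ v ⊩ t ⇔ coord v ≡ k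

      -- The points adjacent to level `k` are at levels `k + 1` and `k - 1`, and `s` removes the
      -- former. For `k = 0` nothing is left.
      beyond-level : ∀ {k s t} → k ≤ℕ n → AtLevel (suc k) s → AtLevel k t →
        ∀ v → ρ ⊢ v ⊩ beyond s t ⇔ suc (coord v) ≡ k
      beyond-level {k} {s} {t} k≤n at-s at-t v = mk⇔ forth back
        where
        forth : ρ ⊢ v ⊩ beyond s t → suc (coord v) ≡ k
        forth p with to (⊩-beyond s t v) p | point k≤n
        ... | f , v⊮s | u , refl with to (adjacent v u) (f u (from (at-t u) refl))
        ...   | inj₁ v→u = v→u
        ...   | inj₂ u→v = contradiction (from (at-s v) (sym u→v)) v⊮s

        back : suc (coord v) ≡ k → ρ ⊢ v ⊩ beyond s t
        back refl = from (⊩-beyond s t v)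
          ( (λ w w⊩t → from (adjacent v w) (inj₁ (sym (to (at-t w) w⊩t))))
          , λ v⊩s → ℕ.<⇒≢ (ℕ.m<n+m (coord v) {2} (s≤s z≤n)) (to (at-s v) v⊩s))

      -- Each link descends one level and the walk dies out below level `0`, so from level `k` there
      -- are exactly `k` links.
      chain-level : ∀ j {k s t} → k ≤ℕ n → AtLevel (suc k) s → AtLevel k t →
        ∀ v → ρ ⊢ v ⊩ chain j s t ⇔ j ≡ k
      chain-level j {zero} {s} {t} 0≤n at-s at-t v = by-length j
        where
        none : ¬ ∃ λ w → ρ ⊢ w ⊩ beyond s t
        none (w , q) = contradiction (to (beyond-level {s = s} {t} 0≤n at-s at-t w) q) λ ()

        by-length : ∀ j → ρ ⊢ v ⊩ chain j s t ⇔ j ≡ 0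
        by-length zero    = mk⇔ (λ _ → refl) (λ _ → from (⊩-last s t v) none)
        by-length (suc j) = mk⇔
          (λ p → contradiction (proj₁ (to (⊩-link j s t v) p)) none) (λ ())
      chain-level j {suc k} {s} {t} k<n at-s at-t v = by-length j
        where
        level : ∀ w → ρ ⊢ w ⊩ beyond s t ⇔ coord w ≡ k
        level w = mk⇔ (ℕ.suc-injective ∘ to 1+level) (from 1+level ∘ cong suc)
          where 1+level = beyond-level {s = s} {t} k<n at-s at-t w

        some : ∃ λ w → ρ ⊢ w ⊩ beyond s t
        some = let (w , w≡k) = point (ℕ.<⇒≤ k<n) in w , from (level w) w≡k

        by-length : ∀ j → ρ ⊢ v ⊩ chain j s t ⇔ j ≡ suc k
        by-length zero    = mk⇔
          (λ p → contradiction some (to (⊩-last s t v) p)) (λ ())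
        by-length (suc j) = mk⇔
          (λ p → cong suc (to rest (proj₂ (to (⊩-link j s t v) p))))
          (λ eq → from (⊩-link j s t v) (some , from rest (ℕ.suc-injective eq)))
          where rest = chain-level j (ℕ.<⇒≤ k<n) at-t level v

      -- The first step has nothing to remove: level `n + 1` is off the path.
      zero-level : AtLevel (suc n) 0#
      zero-level v = mk⇔ (λ ()) λ eq →
        contradiction (subst (_≤ℕ n) eq (bounded v)) ℕ.1+n≰n

    -- The first two links make `P₁ p` and `P₂ p` inhabited, which is what `end-of-path` uses; so
    -- `p` is an end and the chain counts down from level `n`.
    chain-length : ∀ j p v → ρ ⊢ v ⊩ chain (2 + j) 0# p → 2 + j ≡ n
    chain-length j p v h = go em
      where
      P₁-inhabited : ∃ λ w → ρ ⊢ w ⊩ P₁ p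
      P₁-inhabited = proj₁ (to (⊩-link (suc j) 0# p v) h)

      P₂-inhabited : ∃ λ w → ρ ⊢ w ⊩ P₂ p
      P₂-inhabited = proj₁ (to (⊩-link j p (P₁ p) v)
        (proj₂ (to (⊩-link (suc j) 0# p v) h)))

      adjacent-to-p : ∀ w → ρ ⊢ w ⊩ P₁ p → ∀ c → ρ ⊢ c ⊩ p → Adjacent w c
      adjacent-to-p w w⊩P₁ = proj₁ (to (⊩-beyond 0# p w) w⊩P₁)

      adjacent-to-P₁ : ∀ u → ρ ⊢ u ⊩ P₂ p →
        ∀ w → (∀ c → ρ ⊢ c ⊩ p → Adjacent w c) → Adjacent u w
      adjacent-to-P₁ u u⊩P₂ w w~p =
        proj₁ (to (⊩-beyond p (P₁ p) u) u⊩P₂) w (from (⊩-beyond 0# p w) (w~p , λ ()))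

      go : Dec (∃ λ b → ρ ⊢ b ⊩ p) → 2 + j ≡ n
      -- With `p` empty every point is vacuously adjacent to all of it, so `u` would be adjacent to
      -- itself.
      go (no ¬b) =
        let (u , u⊩P₂) = P₂-inhabited in
        contradiction (adjacent-to-P₁ u u⊩P₂ u λ c c⊩p → contradiction (c , c⊩p) ¬b)
                      (apart-refl u)
      go (yes (b , b⊩p)) =
        let (w , w⊩P₁) = P₁-inhabited
            (u , u⊩P₂) = P₂-inhabited
            (d , at-p) = end-of-path (λ c → ρ ⊢ c ⊩ p) {v = u} {w = w} b⊩p
              (adjacent-to-p w w⊩P₁) (proj₂ (to (⊩-beyond p (P₁ p) u) u⊩P₂))
              (adjacent-to-P₁ u u⊩P₂)
        in to (chain-level d (2 + j) {n} {0#} {p} ℕ.≤-refl (zero-level d) at-p v) h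

  pathAlgebra⊨ : ∀ k → pathAlgebra ⊨ chainIdentity k ⇔ k ≢ m
  pathAlgebra⊨ k = mk⇔ refutes satisfies
    where
    formula : Term
    formula = chain (4 + k) 0# (var 0)

    satisfies : k ≢ m → pathAlgebra ⊨ chainIdentity k
    satisfies k≢m ρ = from (≈0⇔unforced (⟦ pathAlgebra ⟧ formula ρ)) λ v h →
      k≢m (ℕ.+-cancelˡ-≡ 4 k m (chain-length ρ (2 + k) (var 0) v h))

    end : UpSet
    end = record
      { lower = λ _ → false ; upper = λ v → left v ≡ᵇ n ; closed = λ _ () }

    refutes : pathAlgebra ⊨ chainIdentity k → k ≢ m
    refutes h refl = to
      (≈0⇔unforced (⟦ pathAlgebra ⟧ formula ρ)) (h ρ) v
      (from (chain-level ρ leftward n {n} {0#} {var 0} ℕ.≤-refl (zero-level ρ leftward)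
        (λ u → mk⇔ (ℕ.≡ᵇ⇒≡ _ _) (ℕ.≡⇒≡ᵇ _ _)) v) refl)
      where
      ρ : ℕ → UpSet
      ρ _ = end
      v : Path n
      v = 0 , n , refl

-- Subvarieties from sets of natural numbers

module _ (em : ExcludedMiddle 0ℓ) where
  open PathAlgebra em

  -- `pathAlgebra m` violates only the chain identity with index `m`, so imposing those with index
  -- outside `S` keeps exactly the path algebras with `m` in `S`.
  identities : (ℕ → Bool) → Pred Identity 1ℓ
  identities S = Axiom ∪ (λ e → ∃ λ k → S k ≡ false × e ≡ chainIdentity k)

  subvariety : (ℕ → Bool) → Subvariety K₂
  subvariety S = record
    { class     = Mod (identities S)
    ; isVariety = identities S , id , id
    ; class⊆    = λ M → Mod⇒K₂ λ e → M e ∘ inj₁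
    }

  pathAlgebra∈subvariety : ∀ S m → Mod (identities S) (pathAlgebra m) ⇔ S m ≡ true
  pathAlgebra∈subvariety S m = mk⇔ forth back
    where
    forth : Mod (identities S) (pathAlgebra m) → S m ≡ true
    forth M with S m in eq
    ... | true  = refl
    ... | false = contradiction refl
      (to (pathAlgebra⊨ m m) (M _ (inj₂ (m , eq , refl))))

    back : S m ≡ true → Mod (identities S) (pathAlgebra m)
    back Sm e (inj₁ ax) = K₂⇒Mod (pathAlgebra∈K₂ m) e ax
    back Sm _ (inj₂ (k , Sk , refl)) = from (pathAlgebra⊨ m k) λ
      { refl → contradiction (trans (sym Sm) Sk) λ () }

  subvariety-mono : ∀ {S S′} → S ≗ S′ →
    ∀ A → Mod (identities S) A → Mod (identities S′) A
  subvariety-mono S≗S′ A M e (inj₁ ax) = M e (inj₁ ax)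
  subvariety-mono S≗S′ A M e (inj₂ (k , S′k , eq)) =
    M e (inj₂ (k , trans (S≗S′ k) S′k , eq))

  subsets↣subvarieties : Injection (ℕ →-setoid Bool) (Lattice.setoid K₂-subvarieties)
  subsets↣subvarieties = record
    { to        = subvariety
    ; cong      = λ S≗S′ →
        (λ {A} → subvariety-mono S≗S′ A) , (λ {A} → subvariety-mono (sym ∘ S≗S′) A)
    ; injective = λ {S} {S′} (S⊆S′ , S′⊆S) m → Bool.⇔→≡ (mk⇔
        (λ p → to (pathAlgebra∈subvariety S′ m)
          (S⊆S′ {pathAlgebra m} (from (pathAlgebra∈subvariety S m) p)))
        (λ p → to (pathAlgebra∈subvariety S m)
          (S′⊆S {pathAlgebra m} (from (pathAlgebra∈subvariety S′ m) p))))
    }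

theorem6p5 : ExcludedMiddle 2ℓ → Bijection (Lattice.setoid K₂-subvarieties) (ℕ →-setoid Bool)
theorem6p5 em = schröder-bernstein em
  (subvarieties↣subsets (lower-em 2ℓ em) K₂-isVariety)
  (subsets↣subvarieties (lower-em 2ℓ em))
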